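{- Let $M,N$ be positive integers, let $x\in\{ -1,1\}^{\mathbb{Z}/N\mathbb{Z}}$ and $y\in\{ -1,1\}^{\mathbb{Z}/M\mathbb{Z}}$, and suppose $\Sigma(x)=\Sigma(y)=0$. Consider the toroidal hitomezashi pattern $\mathrm{Cloth}_{\mathbb{Z}/M\mathbb{Z}\times\mathbb{Z}/N\mathbb{Z}}(x,y)$. (1) If $r(x)<r(y)$, then hitomezashi loops with homology class $(0,1)$ and with homology class $(0,-1)$ exist. (2) If $r(x)=r(y)$, then no hitomezashi loops of nonzero homology class exist. (3) If $r(x)>r(y)$, then hitomezashi loops with homology class $(1,0)$ and with homology class $(-1,0)$ exist.
   Context: Oriented hitomezashi pattern: $\mathrm{Cloth}_{\mathbb{Z}/M\mathbb{Z}\times\mathbb{Z}/N\mathbb{Z}}(x,y)$ is the directed graph on vertex set $\mathbb{Z}/M\mathbb{Z}\times\mathbb{Z}/N\mathbb{Z}$ in which, for each $(i,j)$, the (horizontal) edge between $(i,j)$ and $(i+1,j)$ is oriented $(i,j)\to(i+1,j)$ if $x_j=1$ and $(i+1,j)\to(i,j)$ if $x_j=-1$, and the (vertical) edge between $(i,j)$ and $(i,j+1)$ is oriented $(i,j)\to(i,j+1)$ if $y_i=1$ and $(i,j+1)\to(i,j)$ if $y_i=-1$. A hitomezashi loop is a closed directed circuit following the orientations and alternating between horizontal and vertical edges. Its homology class is $(\Delta x/M,\Delta y/N)$, where $\Delta x$ is the number of its edges of the form $(i,j)\to(i+1,j)$ minus the number of the form $(i+1,j)\to(i,j)$, and $\Delta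 y$ is the number of its edges of the form $(i,j)\to(i,j+1)$ minus the number of the form $(i,j+1)\to(i,j)$. For $z\in\{ -1,1\}^{\mathbb{Z}/K\mathbb{Z}}$, let $\tilde z_i=z_{i\bmod K}$ ($i\in\mathbb{Z}$), $\Sigma(z)=\sum_{i\in\mathbb{Z}/K\mathbb{Z}}z_i$, and for integers $a\le b$, $\Sigma_a^b(z)=\sum_{a\le i\le b}\tilde z_i$, with $\Sigma_{b+1}^b(z)=0$ and $\Sigma_a^b(z)=-\Sigma_{b+1}^{a-1}(z)$ for $a>b+1$. When $\Sigma(z)=0$, the range is $r(z)=\sup\{\Sigma_a^b(z):a\le b+1\}=-\inf\{\Sigma_a^b(z):a\le b+1\}$. -}

module Defs where

open import Data.Nat as ℕ using (ℕ; zero; suc; NonZero)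
open import Data.Nat.DivMod as NDM using ()
open import Data.Fin as Fin using (Fin; toℕ)
open import Data.Integer as ℤ using (ℤ; +_; -_; _+_; _≤_)
open import Data.Integer.DivMod using (_%ℕ_)
open import Data.Sign using (Sign)
open import Data.Bool using (Bool; true; false)
open import Data.Product using (Σ; _×_; _,_; ∃-syntax)
open import Function.Definitions using (Injective)
open import Relation.Binary.PropositionalEquality using (_≡_; _≢_)

------------------------------------------------------------------------
-- Signs ±1 and finite sums

-- the value ±1 ∈ ℤ of a sign
val : Sign → ℤ
val Sign.+ = + 1
val Sign.- = - (+ 1)

-- Σ_{i ∈ Fin k} f i
sumFin : (k : ℕ) → (Fin k → ℤ) → ℤ
sumFin zero    f = + 0
sumFin (suc k) f = f Fin.zero + sumFin k (λ i → f (Fin.suc i))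

------------------------------------------------------------------------
-- Sequences z ∈ {-1,1}^{ℤ/Kℤ}, K = suc k, with Fin (suc k) as ℤ/Kℤ

-- Σ(z)
Σz : (k : ℕ) → (Fin (suc k) → Sign) → ℤ
Σz k z = sumFin (suc k) (λ i → val (z i))

-- the periodic extension z̃ : ℤ → {-1,1},  z̃ i = z (i mod K)
ztil : (k : ℕ) → (Fin (suc k) → Sign) → ℤ → ℤ
ztil k z i = val (z ((i %ℕ suc k) NDM.mod suc k))

-- Σ_{a ≤ i ≤ a + L - 1} z̃ i ; every Σ_a^b with a ≤ b+1 is of this form
-- with L = b - a + 1 ∈ ℕ.
Σab : (k : ℕ) → (Fin (suc k) → Sign) → ℤ → ℕ → ℤ
Σab k z a zero    = + 0
Σab k z a (suc L) = ztil k z a + Σab k z (a + + 1) L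

-- r is the range r(z) = sup { Σ_a^b(z) : a ≤ b + 1 } (supremum, attained,
-- as in the paper; when Σ(z) = 0 this supremum exists)
IsRange : (k : ℕ) → (Fin (suc k) → Sign) → ℤ → Set
IsRange k z r =
  (∀ (a : ℤ) (L : ℕ) → Σab k z a L ≤ r) × (∃[ a ] ∃[ L ] Σab k z a L ≡ r)

------------------------------------------------------------------------
-- The toroidal cloth on ℤ/Mℤ × ℤ/Nℤ, M = suc m, N = suc n

-- cyclic successor i ↦ i + 1 in ℤ/Kℤ
next : {k : ℕ} → Fin (suc k) → Fin (suc k)
next {k} i = (suc (toℕ i)) NDM.mod (suc k)

Vertex : ℕ → ℕ → Set
Vertex m n = Fin (suc m) × Fin (suc n)

-- Edges: H i j is the horizontal edge between (i,j) and (i+1,j);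
--        V i j is the vertical edge between (i,j) and (i,j+1).
data Edge (m n : ℕ) : Set where
  H : Fin (suc m) → Fin (suc n) → Edge m n
  V : Fin (suc m) → Fin (suc n) → Edge m n

-- horizontal (true) or vertical (false)
isH : {m n : ℕ} → Edge m n → Bool
isH (H _ _) = true
isH (V _ _) = false

module Cloth (m n : ℕ) (x : Fin (suc n) → Sign) (y : Fin (suc m) → Sign) where

  -- tail and head of an edge according to its orientation
  tl : Edge m n → Vertex m n
  tl (H i j) with x j
  ... | Sign.+ = (i , j)
  ... | Sign.- = (next i , j)
  tl (V i j) with y i
  ... | Sign.+ = (i , j)
  ... | Sign.- = (i , next j)

  hd : Edge m n → Vertex m n
  hd (H i j) with x j
  ... | Sign.+ = (next i , j)
  ... | Sign.- = (i , j)
  hd (V i j) with y i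
  ... | Sign.+ = (i , next j)
  ... | Sign.- = (i , j)

  -- contribution of an edge (traversed along its orientation) to Δx, Δy
  dx : Edge m n → ℤ
  dx (H i j) = val (x j)
  dx (V i j) = + 0

  dy : Edge m n → ℤ
  dy (H i j) = + 0
  dy (V i j) = val (y i)

  -- A hitomezashi loop: a closed directed circuit e₀ → e₁ → … → e_{k} → e₀
  -- (cyclically indexed by Fin (suc k)), each edge followed along its
  -- orientation, consecutive edges alternating horizontal / vertical,
  -- and no edge repeated.
  record Loop : Set where
    field
      len   : ℕ
      edge  : Fin (suc len) → Edge m n
      link  : ∀ t → hd (edge t) ≡ tl (edge (next t))
      alt   : ∀ t → isH (edge t) ≢ isH (edge (next t))
      circ  : Injective _≡_ _≡_ edge
    Δx : ℤ
    Δx = sumFin (suc len) (λ t → dx (edge t))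
    Δy : ℤ
    Δy = sumFin (suc len) (λ t → dy (edge t))

  open Loop public

  -- a loop has homology class (Δx/M, Δy/N) = (p, q)  ⇔  Δx = p·M, Δy = q·N
  HasClass : Loop → ℤ → ℤ → Set
  HasClass ℓ p q = Δx ℓ ≡ p ℤ.* (+ suc m) × Δy ℓ ≡ q ℤ.* (+ suc n)

{-# OPTIONS --safe #-}
-- Let A and B be the partial-sum walks of x and y around their cycles; they range over
-- intervals of lengths r(x) and r(y). Give each edge the level A j - B i, where (i , j) is the
-- upper-right corner of the face on the left of the edge. At each turn of a hitomezashi path
-- the two edges have the same face on their left, or two faces diagonally opposite at the
-- turning vertex whose levels agree because of the signs of x and y there; so every loop has
-- a constant level. Its vertical winding Δy is N times its signed number of vertical edges
-- between two fixed adjacent rows.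
-- If r(y) ≤ r(x), the vertical edges just below a row where A is maximal all have levels above
-- the loop's level when that is at most max A - max B, and otherwise those just below a row
-- where A is minimal all have levels below it; so Δy = 0, and by transposition Δx = 0 if
-- r(x) ≤ r(y).
-- If r(x) < r(y), choose columns running from a minimum of B to a maximum of B with B strictly
-- in between, and follow the loop through the upward edge in the first of them just below a
-- row where A is minimal. Its level min A - min B keeps it within these columns, where no other
-- vertical edge just below that row has this level, so the loop has class (0,1). Negating x
-- and y reverses loops, and transposing swaps x and y; this gives the other three classes.
module Submission where

open import Defs
open import Data.Bool using (true; false; not; if_then_else_)
open import Data.Bool.Properties using (not-¬; not-injective)
open import Data.Fin as F using (Fin; zero; suc; toℕ; fromℕ; fromℕ<; inject; inject₁; opposite)
import Data.Fin.Properties as FP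
open import Data.Fin.Permutation using (Permutation′; permutation; reverse)
open import Data.Integer as ℤ using (ℤ; +_; -_; _+_; _-_; _*_; -1ℤ; ∣_∣; _⊖_; _%ℕ_; _/ℕ_; _≤_; _<_)
open import Data.Integer.DivMod using (a≡a%ℕn+[a/ℕn]*n; n%ℕd<d)
import Data.Integer.Properties as ℤP
open import Data.Integer.Tactic.RingSolver using (solve-∀)
open import Algebra.Properties.CommutativeMonoid.Sum ℤP.+-0-commutativeMonoid
  using (sum; sum-cong-≗; sum-replicate-zero; ∑-permute; ∑-distrib-+)
open import Algebra.Properties.Semiring.Sum ℤP.+-*-semiring using (*-distribˡ-sum)
open import Data.Nat as ℕ using (ℕ; zero; suc; z≤n; s≤s)
import Data.Nat.DivMod as NDM
import Data.Nat.Properties as ℕP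
open import Data.Product using (∃-syntax; ∃₂; _,_; _×_; proj₁; proj₂; uncurry; swap; map; map₂)
open import Data.Sign as Sign using (Sign)
open import Data.Sum using (_⊎_; inj₁; inj₂; [_,_]′)
open import Function using (_∘_)
open import Function.Definitions using (Injective)
open import Relation.Binary.Definitions using (DecidableEquality; tri<; tri≈; tri>)
open import Relation.Binary.PropositionalEquality
open import Relation.Nullary using (¬_; ¬?; yes; no; does; contradiction)
open import Relation.Nullary.Decidable using (map′; decidable-stable)
open import Relation.Unary using (Decidable)

module _ {k : ℕ} where

  open import Function.Endo.Propositional (Fin (suc k)) using (_^_; ^-homo)

  data Position (i : Fin (suc k)) : Set where
    below-last : toℕ i ℕ.< k → Position i
    at-last    : toℕ i ≡ k → Position i

  position : (i : Fin (suc k)) → Position i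
  position i with ℕP.m≤n⇒m<n∨m≡n (FP.toℕ≤pred[n] i)
  ... | inj₁ i<k = below-last i<k
  ... | inj₂ i≡k = at-last i≡k

  toℕ-next : (i : Fin (suc k)) → toℕ i ℕ.< k → toℕ (next i) ≡ suc (toℕ i)
  toℕ-next i i<k = trans (FP.toℕ-fromℕ< _) (NDM.m<n⇒m%n≡m (s≤s i<k))

  next-last : (i : Fin (suc k)) → toℕ i ≡ k → next i ≡ zero
  next-last i i≡k = FP.toℕ-injective (begin
    toℕ (next i)               ≡⟨ FP.toℕ-fromℕ< _ ⟩
    suc (toℕ i) NDM.% suc k    ≡⟨ cong (λ t → suc t NDM.% suc k) i≡k ⟩
    suc k NDM.% suc k          ≡⟨ NDM.n%n≡0 (suc k) ⟩
    0                          ∎)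
    where open ≡-Reasoning

  next-injective : Injective _≡_ _≡_ (next {k})
  next-injective {i} {j} eq with position i | position j
  ... | below-last i<k | below-last j<k =
    FP.toℕ-injective (ℕP.suc-injective (trans (sym (toℕ-next i i<k)) (trans (cong toℕ eq) (toℕ-next j j<k))))
  ... | below-last i<k | at-last j≡k
    with () ← trans (sym (toℕ-next i i<k)) (cong toℕ (trans eq (next-last j j≡k)))
  ... | at-last i≡k | below-last j<k
    with () ← trans (sym (toℕ-next j j<k)) (cong toℕ (trans (sym eq) (next-last i i≡k)))
  ... | at-last i≡k | at-last j≡k = FP.toℕ-injective (trans i≡k (sym j≡k))

  prev : Fin (suc k) → Fin (suc k)
  prev zero    = fromℕ k
  prev (suc i) = inject₁ i

  next-prev : ∀ i → next (prev i) ≡ i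
  next-prev zero    = next-last (fromℕ k) (FP.toℕ-fromℕ k)
  next-prev (suc i) = FP.toℕ-injective (trans (toℕ-next (inject₁ i) i<k) (cong suc (FP.toℕ-inject₁ i)))
    where
    i<k : toℕ (inject₁ i) ℕ.< k
    i<k = subst (ℕ._< k) (sym (FP.toℕ-inject₁ i)) (FP.toℕ<n i)

  prev-next : ∀ i → prev (next i) ≡ i
  prev-next i = next-injective (next-prev (next i))

  rotation : Permutation′ (suc k)
  rotation = permutation next prev next-prev prev-next

  next-opposite : ∀ i → next (opposite (next i)) ≡ opposite i
  next-opposite i with position i
  ... | at-last i≡k = begin
    next (opposite (next i))  ≡⟨ cong (next ∘ opposite) (next-last i i≡k) ⟩
    next (fromℕ k)            ≡⟨ next-last (fromℕ k) (FP.toℕ-fromℕ k) ⟩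
    zero                      ≡⟨ FP.toℕ-injective toℕ-opposite ⟨
    opposite i                ∎
    where
    open ≡-Reasoning
    toℕ-opposite : toℕ (opposite i) ≡ 0
    toℕ-opposite = trans (FP.opposite-prop i) (trans (cong (k ℕ.∸_) i≡k) (ℕP.n∸n≡0 k))
  ... | below-last i<k = FP.toℕ-injective (begin
    toℕ (next (opposite (next i)))  ≡⟨ toℕ-next _ opp<k ⟩
    suc (toℕ (opposite (next i)))   ≡⟨ cong suc toℕ-opp ⟩
    suc (k ℕ.∸ suc (toℕ i))         ≡⟨ ℕP.+-∸-assoc 1 i<k ⟨
    k ℕ.∸ toℕ i                     ≡⟨ FP.opposite-prop i ⟨
    toℕ (opposite i)                ∎)
    where
    open ≡-Reasoning
    toℕ-opp : toℕ (opposite (next i)) ≡ k ℕ.∸ suc (toℕ i)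
    toℕ-opp = trans (FP.opposite-prop (next i)) (cong (k ℕ.∸_) (toℕ-next i i<k))
    opp<k : toℕ (opposite (next i)) ℕ.< k
    opp<k = subst (ℕ._< k) (sym toℕ-opp) (ℕP.∸-monoʳ-< {k} {suc (toℕ i)} {0} (s≤s ℕ.z≤n) i<k)

  toℕ-next^ : ∀ d i → toℕ i ℕ.+ d ℕ.≤ k → toℕ ((next ^ d) i) ≡ toℕ i ℕ.+ d
  toℕ-next^ zero    i _ = sym (ℕP.+-identityʳ (toℕ i))
  toℕ-next^ (suc d) i i+d≤k = begin
    toℕ (next ((next ^ d) i))  ≡⟨ toℕ-next _ (subst (ℕ._< k) (sym IH) (subst (ℕ._≤ k) (ℕP.+-suc (toℕ i) d) i+d≤k)) ⟩
    suc (toℕ ((next ^ d) i))   ≡⟨ cong suc IH ⟩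
    suc (toℕ i ℕ.+ d)          ≡⟨ ℕP.+-suc (toℕ i) d ⟨
    toℕ i ℕ.+ suc d            ∎
    where
    open ≡-Reasoning
    IH = toℕ-next^ d i (ℕP.≤-trans (ℕP.+-monoʳ-≤ (toℕ i) (ℕP.n≤1+n d)) i+d≤k)

  next^-from-zero : ∀ i → (next ^ toℕ i) zero ≡ i
  next^-from-zero i = FP.toℕ-injective (toℕ-next^ (toℕ i) zero (FP.toℕ≤pred[n] i))

  next^-to-zero : ∀ i → (next ^ suc (k ℕ.∸ toℕ i)) i ≡ zero
  next^-to-zero i = next-last _ (trans (toℕ-next^ (k ℕ.∸ toℕ i) i (ℕP.≤-reflexive i+[k-i]≡k)) i+[k-i]≡k)
    where
    i+[k-i]≡k : toℕ i ℕ.+ (k ℕ.∸ toℕ i) ≡ k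
    i+[k-i]≡k = ℕP.m+[n∸m]≡n (FP.toℕ≤pred[n] i)

  reachable : ∀ i j → ∃[ d ] (next ^ d) i ≡ j
  reachable i j = toℕ j ℕ.+ suc (k ℕ.∸ toℕ i) , (begin
    (next ^ (toℕ j ℕ.+ suc (k ℕ.∸ toℕ i))) i          ≡⟨ cong-app (^-homo next (toℕ j) _) i ⟩
    (next ^ toℕ j) ((next ^ suc (k ℕ.∸ toℕ i)) i)     ≡⟨ cong (next ^ toℕ j) (next^-to-zero i) ⟩
    (next ^ toℕ j) zero                               ≡⟨ next^-from-zero j ⟩
    j                                                 ∎)
    where open ≡-Reasoning

  cyclic-induction : (P : Fin (suc k) → Set) → P zero → (∀ i → P i → P (next i)) → ∀ i → P i
  cyclic-induction P P0 step i = subst P (next^-from-zero i) (go (toℕ i))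
    where
    go : ∀ d → P ((next ^ d) zero)
    go zero    = P0
    go (suc d) = step _ (go d)

sumFin≡sum : ∀ k (f : Fin k → ℤ) → sumFin k f ≡ sum f
sumFin≡sum zero    f = refl
sumFin≡sum (suc k) f = cong (λ s → f zero + s) (sumFin≡sum k (f ∘ suc))

sumFin-cong : ∀ {k} {f g : Fin k → ℤ} → (∀ t → f t ≡ g t) → sumFin k f ≡ sumFin k g
sumFin-cong {k} {f} {g} f≗g = trans (sumFin≡sum k f) (trans (sum-cong-≗ f≗g) (sym (sumFin≡sum k g)))

∑-rotate : ∀ {k} (f : Fin (suc k) → ℤ) → sum (f ∘ next) ≡ sum f
∑-rotate f = sym (∑-permute f rotation)

∑-reverse : ∀ {k} (f : Fin k → ℤ) → sum (f ∘ opposite) ≡ sum f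
∑-reverse f = sym (∑-permute f reverse)

∑-neg : ∀ {k} (f : Fin k → ℤ) → sum (-_ ∘ f) ≡ - sum f
∑-neg f = begin
  sum (-_ ∘ f)            ≡⟨ sum-cong-≗ (λ i → sym (ℤP.-1*i≡-i (f i))) ⟩
  sum ((-1ℤ *_) ∘ f)      ≡⟨ *-distribˡ-sum -1ℤ f ⟨
  -1ℤ * sum f             ≡⟨ ℤP.-1*i≡-i (sum f) ⟩
  - sum f                 ∎
  where open ≡-Reasoning

∑-telescope : ∀ {k} (g : Fin (suc k) → ℤ) → sum (λ t → g (next t) - g t) ≡ + 0
∑-telescope g = begin
  sum (λ t → g (next t) - g t)     ≡⟨ ∑-distrib-+ (g ∘ next) (-_ ∘ g) ⟩
  sum (g ∘ next) + sum (-_ ∘ g)    ≡⟨ cong₂ _+_ (∑-rotate g) (∑-neg g) ⟩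
  sum g - sum g                    ≡⟨ ℤP.+-inverseʳ (sum g) ⟩
  + 0                              ∎
  where open ≡-Reasoning

%ℕ-unique : ∀ u d .{{_ : ℕ.NonZero d}} {r} q → r ℕ.< d → u ≡ + r + q * + d → u %ℕ d ≡ r
%ℕ-unique u d {r} q r<d u≡r+qd = sym (ℤP.+-injective (ℤP.i-j≡0⇒i≡j (+ r) (+ r′) r-r′≡0))
  where
  r′ = u %ℕ d
  δ = u /ℕ d - q
  r-r′≡δd : + r - + r′ ≡ δ * + d
  r-r′≡δd = begin
    + r - + r′                               ≡⟨ shift (+ r) (+ r′) q (+ d) ⟩
    (+ r + q * + d) - (+ r′ + q * + d)       ≡⟨ cong (λ v → v - (+ r′ + q * + d)) (trans (sym u≡r+qd) (a≡a%ℕn+[a/ℕn]*n u d)) ⟩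
    (+ r′ + u /ℕ d * + d) - (+ r′ + q * + d) ≡⟨ cancel (+ r′) (u /ℕ d) q (+ d) ⟩
    δ * + d                                  ∎
    where
    open ≡-Reasoning
    shift : ∀ a b c e → a - b ≡ (a + c * e) - (b + c * e)
    shift = solve-∀
    cancel : ∀ b p c e → (b + p * e) - (b + c * e) ≡ (p - c) * e
    cancel = solve-∀
  ∣δ∣d<d : ∣ δ ∣ ℕ.* d ℕ.< d
  ∣δ∣d<d = begin-strict
    ∣ δ ∣ ℕ.* d     ≡⟨ ℤP.abs-* δ (+ d) ⟨
    ∣ δ * + d ∣     ≡⟨ cong ∣_∣ (trans (sym r-r′≡δd) (ℤP.m-n≡m⊖n r r′)) ⟩
    ∣ r ⊖ r′ ∣      ≤⟨ ℤP.∣m⊝n∣≤m⊔n r r′ ⟩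
    r ℕ.⊔ r′        <⟨ ℕP.⊔-pres-<m r<d (n%ℕd<d u d) ⟩
    d               ∎
    where open ℕP.≤-Reasoning
  δ≡0 : δ ≡ + 0
  δ≡0 with ∣ δ ∣ in ∣δ∣≡
  ... | zero  = ℤP.∣i∣≡0⇒i≡0 ∣δ∣≡
  ... | suc t = contradiction (ℕP.m≤n*m d (suc t)) (ℕP.<⇒≱ (subst (λ a → a ℕ.* d ℕ.< d) ∣δ∣≡ ∣δ∣d<d))
  r-r′≡0 : + r - + r′ ≡ + 0
  r-r′≡0 = trans r-r′≡δd (cong (_* + d) δ≡0)

≤-translate : ∀ {a b c d} k → a ≤ b → a + k ≡ c → b + k ≡ d → c ≤ d
≤-translate k a≤b a+k≡c b+k≡d = subst₂ _≤_ a+k≡c b+k≡d (ℤP.+-monoˡ-≤ k a≤b)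

<-translate : ∀ {a b c d} k → a < b → a + k ≡ c → b + k ≡ d → c < d
<-translate k a<b a+k≡c b+k≡d = subst₂ _<_ a+k≡c b+k≡d (ℤP.+-monoˡ-< k a<b)

between : ∀ {a a′ b b′ α β} → a < α → α ≤ a′ → α - β ≡ a - b → a′ - a < b′ - b → b < β × β < b′
between {a} {a′} {b} {b′} {α} {β} a<α α≤a′ α-β≡a-b gap =
  <-translate (b - a) a<α (a+[b-a]≡b a b) (sym β≡) ,
  ℤP.≤-<-trans (≤-translate (b - a) α≤a′ (sym β≡) refl) (<-translate b gap (regroup a′ a b) (cancel b′ b))
  where
  β≡ : β ≡ α + (b - a)
  β≡ = begin
    β                 ≡⟨ double-difference α β ⟩
    α - (α - β)       ≡⟨ cong (_-_ α) α-β≡a-b ⟩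
    α - (a - b)       ≡⟨ distribute α a b ⟩
    α + (b - a)       ∎
    where
    open ≡-Reasoning
    double-difference : ∀ α β → β ≡ α - (α - β)
    double-difference = solve-∀
    distribute : ∀ α a b → α - (a - b) ≡ α + (b - a)
    distribute = solve-∀
  a+[b-a]≡b : ∀ a b → a + (b - a) ≡ b
  a+[b-a]≡b = solve-∀
  regroup : ∀ a′ a b → a′ - a + b ≡ a′ + (b - a)
  regroup = solve-∀
  cancel : ∀ b′ b → b′ - b + b ≡ b′
  cancel = solve-∀

record Spread {k} (h : Fin (suc k) → ℤ) (r : ℤ) : Set where
  field
    lo hi  : Fin (suc k)
    lo-min : ∀ i → h lo ≤ h i
    hi-max : ∀ i → h i ≤ h hi
    hi-lo  : h hi - h lo ≡ r

spread : ∀ {k} {h : Fin (suc k) → ℤ} {r} lo hi →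
         (∀ i j → h j - h i ≤ r) → h hi - h lo ≡ r → Spread h r
spread {h = h} lo hi bound hi-lo = record
  { lo = lo ; hi = hi ; hi-lo = hi-lo
  ; lo-min = λ i → ≤-translate (h lo + h i - h hi) (subst (h hi - h i ≤_) (sym hi-lo) (bound i hi))
                     (cancel₁ (h hi) (h i) (h lo)) (cancel₂ (h hi) (h i) (h lo))
  ; hi-max = λ i → ≤-translate (h lo) (subst (h i - h lo ≤_) (sym hi-lo) (bound lo i))
                     (cancel₃ (h i) (h lo)) (cancel₃ (h hi) (h lo))
  }
  where
  cancel₁ : ∀ a b c → a - b + (c + b - a) ≡ c
  cancel₁ = solve-∀
  cancel₂ : ∀ a b c → a - c + (c + b - a) ≡ b
  cancel₂ = solve-∀
  cancel₃ : ∀ a b → a - b + b ≡ a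
  cancel₃ = solve-∀

neg-spread : ∀ {k} {h : Fin (suc k) → ℤ} {r} → Spread h r → Spread (-_ ∘ h) r
neg-spread {h = h} S = record
  { lo = hi ; hi = lo
  ; lo-min = λ i → ℤP.neg-mono-≤ (hi-max i)
  ; hi-max = λ i → ℤP.neg-mono-≤ (lo-min i)
  ; hi-lo = trans (negate-diff (h lo) (h hi)) hi-lo
  }
  where
  open Spread S
  negate-diff : ∀ a b → - a - - b ≡ b - a
  negate-diff = solve-∀

module _ {k} {h : Fin (suc k) → ℤ} {r} (S : Spread h r) where

  open Spread S

  0≤r : + 0 ≤ r
  0≤r = subst (+ 0 ≤_) hi-lo (ℤP.i≤j⇒0≤j-i (lo-min hi))

  0<r⇒lo<hi : + 0 < r → h lo < h hi
  0<r⇒lo<hi 0<r = <-translate (h lo) 0<r (ℤP.+-identityˡ (h lo)) (trans (cong (_+ h lo) (sym hi-lo)) (cancel (h hi) (h lo)))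
    where
    cancel : ∀ a b → a - b + b ≡ a
    cancel = solve-∀

record Profile {k} (z : Fin (suc k) → Sign) (r : ℤ) : Set where
  field
    walk      : Fin (suc k) → ℤ
    walk-next : ∀ i → walk (next i) ≡ walk i + val (z i)
    range     : Spread walk r
  open Spread range public

neg : ∀ {k} → (Fin k → Sign) → Fin k → Sign
neg z = Sign.opposite ∘ z

val-opposite : ∀ s → val (Sign.opposite s) ≡ - val s
val-opposite Sign.+ = refl
val-opposite Sign.- = refl

neg-profile : ∀ {k} {z : Fin (suc k) → Sign} {r} → Profile z r → Profile (neg z) r
neg-profile {z = z} P = record
  { walk      = -_ ∘ walk
  ; walk-next = λ i → trans (cong -_ (walk-next i))
                    (trans (ℤP.neg-distrib-+ (walk i) (val (z i))) (cong (λ v → - walk i + v) (sym (val-opposite (z i)))))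
  ; range     = neg-spread range
  }
  where open Profile P

module _ {k} {z : Fin (suc k) → Sign} {r} (P : Profile z r) where

  open Profile P

  ascent : ∀ {i} → z i ≡ Sign.+ → walk i < walk (next i)
  ascent {i} zᵢ≡+ = ℤP.suc[i]≤j⇒i<j (ℤP.≤-reflexive (sym (begin
    walk (next i)          ≡⟨ walk-next i ⟩
    walk i + val (z i)     ≡⟨ cong (λ s → walk i + val s) zᵢ≡+ ⟩
    walk i + + 1           ≡⟨ ℤP.+-comm (walk i) (+ 1) ⟩
    + 1 + walk i           ∎)))
    where open ≡-Reasoning

  descent : ∀ {i} → z i ≡ Sign.- → walk (next i) < walk i
  descent {i} zᵢ≡- = ℤP.suc[i]≤j⇒i<j (ℤP.≤-reflexive (begin
    + 1 + walk (next i)           ≡⟨ cong (λ w → + 1 + w) (walk-next i) ⟩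
    + 1 + (walk i + val (z i))    ≡⟨ cong (λ s → + 1 + (walk i + val s)) zᵢ≡- ⟩
    + 1 + (walk i - + 1)          ≡⟨ cancel (walk i) ⟩
    walk i                        ∎))
    where
    open ≡-Reasoning
    cancel : ∀ w → + 1 + (w - + 1) ≡ w
    cancel = solve-∀

  ascent-at-min : ∀ {i} → walk i ≡ walk lo → z i ≡ Sign.+
  ascent-at-min {i} at-min with z i in zᵢ
  ... | Sign.+ = refl
  ... | Sign.- = contradiction (lo-min (next i)) (ℤP.<⇒≱ (subst (walk (next i) <_) at-min (descent zᵢ)))

module _ (k : ℕ) (z : Fin (suc k) → Sign) where

  open import Function.Endo.Propositional (Fin (suc k)) using (_^_)

  -- ztil k z u is val (z (wrap u)) by definition.
  wrap : ℤ → Fin (suc k)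
  wrap u = (u %ℕ suc k) NDM.mod suc k

  toℕ-wrap : ∀ u → toℕ (wrap u) ≡ u %ℕ suc k
  toℕ-wrap u = trans (FP.toℕ-fromℕ< _) (NDM.m<n⇒m%n≡m (n%ℕd<d u (suc k)))

  wrap-toℕ : ∀ i → wrap (+ toℕ i) ≡ i
  wrap-toℕ i = FP.toℕ-injective (trans (toℕ-wrap (+ toℕ i)) (NDM.m<n⇒m%n≡m (FP.toℕ<n i)))

  wrap-suc : ∀ u → wrap (u + + 1) ≡ next (wrap u)
  wrap-suc u = FP.toℕ-injective (begin
    toℕ (wrap (u + + 1))         ≡⟨ toℕ-wrap (u + + 1) ⟩
    (u + + 1) %ℕ K               ≡⟨ %ℕ-unique (u + + 1) K (u /ℕ K + + (suc r NDM./ K)) (NDM.m%n<n (suc r) K) u+1≡ ⟩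
    suc r NDM.% K                ≡⟨ cong (λ t → suc t NDM.% K) (toℕ-wrap u) ⟨
    suc (toℕ (wrap u)) NDM.% K   ≡⟨ FP.toℕ-fromℕ< _ ⟨
    toℕ (next (wrap u))          ∎)
    where
    open ≡-Reasoning
    K = suc k
    r = u %ℕ K
    regroup : ∀ a q K → a + q * K + + 1 ≡ (+ 1 + a) + q * K
    regroup = solve-∀
    collect : ∀ a b q K → a + b * K + q * K ≡ a + (q + b) * K
    collect = solve-∀
    u+1≡ : u + + 1 ≡ + (suc r NDM.% K) + (u /ℕ K + + (suc r NDM./ K)) * + K
    u+1≡ = begin
      u + + 1                                              ≡⟨ cong (_+ + 1) (a≡a%ℕn+[a/ℕn]*n u K) ⟩
      + r + u /ℕ K * + K + + 1                             ≡⟨ regroup (+ r) (u /ℕ K) (+ K) ⟩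
      + suc r + u /ℕ K * + K                               ≡⟨ cong (λ t → + t + u /ℕ K * + K) (NDM.m≡m%n+[m/n]*n (suc r) K) ⟩
      + (suc r NDM.% K) + + (suc r NDM./ K ℕ.* K) + u /ℕ K * + K
        ≡⟨ cong (λ t → + (suc r NDM.% K) + t + u /ℕ K * + K) (ℤP.pos-* (suc r NDM./ K) K) ⟩
      + (suc r NDM.% K) + + (suc r NDM./ K) * + K + u /ℕ K * + K
        ≡⟨ collect (+ (suc r NDM.% K)) (+ (suc r NDM./ K)) (u /ℕ K) (+ K) ⟩
      + (suc r NDM.% K) + (u /ℕ K + + (suc r NDM./ K)) * + K ∎

  wrap-+ : ∀ u d → wrap (u + + d) ≡ (next ^ d) (wrap u)
  wrap-+ u zero    = cong wrap (ℤP.+-identityʳ u)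
  wrap-+ u (suc d) = begin
    wrap (u + + suc d)        ≡⟨ cong wrap (reassoc u (+ d)) ⟩
    wrap (u + + d + + 1)      ≡⟨ wrap-suc (u + + d) ⟩
    next (wrap (u + + d))     ≡⟨ cong next (wrap-+ u d) ⟩
    next ((next ^ d) (wrap u)) ∎
    where
    open ≡-Reasoning
    reassoc : ∀ u d → u + (+ 1 + d) ≡ u + d + + 1
    reassoc = solve-∀

  Σab-snoc : ∀ a L → Σab k z a (suc L) ≡ Σab k z a L + ztil k z (a + + L)
  Σab-snoc a zero    = trans (ℤP.+-comm (ztil k z a) (+ 0)) (cong (λ v → + 0 + ztil k z v) (sym (ℤP.+-identityʳ a)))
  Σab-snoc a (suc L) = begin
    ztil k z a + Σab k z (a + + 1) (suc L)
      ≡⟨ cong (_+_ (ztil k z a)) (Σab-snoc (a + + 1) L) ⟩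
    ztil k z a + (Σab k z (a + + 1) L + ztil k z (a + + 1 + + L))
      ≡⟨ ℤP.+-assoc (ztil k z a) _ _ ⟨
    Σab k z a (suc L) + ztil k z (a + + 1 + + L)
      ≡⟨ cong (λ v → Σab k z a (suc L) + ztil k z v) (ℤP.+-assoc a (+ 1) (+ L)) ⟩
    Σab k z a (suc L) + ztil k z (a + + suc L)
      ∎
    where open ≡-Reasoning

  Σab-as-sumFin : ∀ L s → Σab k z (+ s) L ≡ sumFin L (λ t → ztil k z (+ (s ℕ.+ toℕ t)))
  Σab-as-sumFin zero    s = refl
  Σab-as-sumFin (suc L) s = cong₂ _+_
    (cong (ztil k z ∘ +_) (sym (ℕP.+-identityʳ s)))
    (trans (cong (λ t → Σab k z (+ t) L) (ℕP.+-comm s 1))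
      (trans (Σab-as-sumFin L (suc s)) (sumFin-cong {L} (λ t → cong (ztil k z ∘ +_) (sym (ℕP.+-suc s (toℕ t)))))))

  prefix : Fin (suc k) → ℤ
  prefix i = Σab k z (+ 0) (toℕ i)

  prefix-suc : ∀ i → Σab k z (+ 0) (suc (toℕ i)) ≡ prefix i + val (z i)
  prefix-suc i = trans (Σab-snoc (+ 0) (toℕ i)) (cong (λ v → prefix i + val (z v)) (wrap-toℕ i))

  Σab-period : Σab k z (+ 0) (suc k) ≡ Σz k z
  Σab-period = trans (Σab-as-sumFin (suc k) 0) (sumFin-cong (λ t → cong (val ∘ z) (wrap-toℕ t)))

  module _ (balanced : Σz k z ≡ + 0) where

    prefix-next : ∀ i → prefix (next i) ≡ prefix i + val (z i)
    prefix-next i with position i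
    ... | below-last i<k = trans (cong (Σab k z (+ 0)) (toℕ-next i i<k)) (prefix-suc i)
    ... | at-last i≡k = begin
      prefix (next i)               ≡⟨ cong prefix (next-last i i≡k) ⟩
      + 0                           ≡⟨ trans Σab-period balanced ⟨
      Σab k z (+ 0) (suc k)         ≡⟨ cong (λ t → Σab k z (+ 0) (suc t)) i≡k ⟨
      Σab k z (+ 0) (suc (toℕ i))   ≡⟨ prefix-suc i ⟩
      prefix i + val (z i)          ∎
      where open ≡-Reasoning

    Σab≡prefix-diff : ∀ a L → Σab k z a L ≡ prefix (wrap (a + + L)) - prefix (wrap a)
    Σab≡prefix-diff a zero = sym (trans (cong (λ v → prefix (wrap v) - prefix (wrap a)) (ℤP.+-identityʳ a))
                                        (ℤP.+-inverseʳ (prefix (wrap a))))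
    Σab≡prefix-diff a (suc L) = begin
      t + Σab k z (a + + 1) L
        ≡⟨ cong (_+_ t) (Σab≡prefix-diff (a + + 1) L) ⟩
      t + (prefix (wrap (a + + 1 + + L)) - prefix (wrap (a + + 1)))
        ≡⟨ cong₂ (λ u v → t + (prefix (wrap u) - prefix v)) (ℤP.+-assoc a (+ 1) (+ L)) (wrap-suc a) ⟩
      t + (end - prefix (next (wrap a)))
        ≡⟨ cong (λ v → t + (end - v)) (prefix-next (wrap a)) ⟩
      t + (end - (prefix (wrap a) + t))
        ≡⟨ cancel t end (prefix (wrap a)) ⟩
      end - prefix (wrap a)
        ∎
      where
      open ≡-Reasoning
      t = ztil k z a
      end = prefix (wrap (a + + suc L))
      cancel : ∀ t p q → t + (p - (q + t)) ≡ p - q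
      cancel = solve-∀

    profile : ∀ {r} → IsRange k z r → Profile z r
    profile {r} (bounded , a , L , attained) = record
      { walk      = prefix
      ; walk-next = prefix-next
      ; range     = spread (wrap a) (wrap (a + + L)) bound (trans (sym (Σab≡prefix-diff a L)) attained)
      }
      where
      bound : ∀ i j → prefix j - prefix i ≤ r
      bound i j with reachable i j
      ... | d , i↝j = subst (_≤ r) (trans (Σab≡prefix-diff (+ toℕ i) d) (cong₂ (λ u v → prefix u - prefix v)
                        (trans (wrap-+ (+ toℕ i) d) (trans (cong (next ^ d) (wrap-toℕ i)) i↝j)) (wrap-toℕ i)))
                        (bounded (+ toℕ i) d)

module _ {P Q : ℕ → Set} (P? : Decidable P) (Q? : Decidable Q) where

  Clear : ℕ → Set
  Clear t = ¬ P t × ¬ Q t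

  Segment : Set
  Segment = ∃₂ λ a L → P a × Q (suc L ℕ.+ a) × (∀ t → t ℕ.< L → Clear (suc t ℕ.+ a))

  private
    scan : ∀ r a L → P a → (∀ t → t ℕ.< L → Clear (suc t ℕ.+ a)) → Q (r ℕ.+ (suc L ℕ.+ a)) → Segment
    scan zero    a L Pa clear Q-end = a , L , Pa , Q-end , clear
    scan (suc r) a L Pa clear Q-end with Q? (suc L ℕ.+ a) | P? (suc L ℕ.+ a)
    ... | yes Q-here | _          = a , L , Pa , Q-here , clear
    ... | no ¬Q-here | yes P-here = scan r (suc L ℕ.+ a) 0 P-here (λ _ ()) (subst Q (sym (ℕP.+-suc r _)) Q-end)
    ... | no ¬Q-here | no ¬P-here = scan r a (suc L) Pa clear′ (subst Q (sym (ℕP.+-suc r _)) Q-end)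
      where
      clear′ : ∀ t → t ℕ.< suc L → Clear (suc t ℕ.+ a)
      clear′ t t<1+L with ℕP.m<1+n⇒m<n∨m≡n t<1+L
      ... | inj₁ t<L  = clear t t<L
      ... | inj₂ refl = ¬P-here , ¬Q-here

  segment : P 0 → ∀ r → Q (suc r) → Segment
  segment P0 r Q-end = scan r 0 0 P0 (λ _ ()) (subst Q (ℕP.+-comm 1 r) Q-end)

module Arcs {k} {h : Fin (suc k) → ℤ} {r} (S : Spread h r) (lo<hi : h (Spread.lo S) < h (Spread.hi S)) where

  open Spread S
  open import Function.Endo.Propositional (Fin (suc k)) using (_^_; ^-homo)

  record Arc : Set where
    field
      start     : Fin (suc k)
      len       : ℕ
      start-min : h start ≡ h lo
      end-max   : h ((next ^ suc len) start) ≡ h hi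
      inside    : ∀ d → d ℕ.< len → h lo < h ((next ^ suc d) start) × h ((next ^ suc d) start) < h hi

    OnArc : Fin (suc k) → Set
    OnArc i = ∃[ d ] d ℕ.≤ len × (next ^ d) start ≡ i

    on-arc-right : ∀ {i} → OnArc i → h (next i) < h hi → OnArc (next i)
    on-arc-right (d , d≤len , reach) below with ℕP.m≤n⇒m<n∨m≡n d≤len
    ... | inj₁ d<len = suc d , d<len , cong next reach
    ... | inj₂ refl  = contradiction (trans (cong (h ∘ next) (sym reach)) end-max) (ℤP.<⇒≢ below)

    on-arc-left : ∀ {i} → OnArc (next i) → h lo < h (next i) → OnArc i
    on-arc-left (zero , _ , reach)      above = contradiction (trans (cong h (sym reach)) start-min) (ℤP.<⇒≢ above ∘ sym)
    on-arc-left (suc d , d<len , reach) above = d , ℕP.<⇒≤ d<len , next-injective reach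

    on-arc-min : ∀ {i} → OnArc i → h i ≡ h lo → i ≡ start
    on-arc-min (zero , _ , reach)      _      = sym reach
    on-arc-min (suc d , d<len , reach) at-min = contradiction (trans (cong h reach) at-min) (ℤP.<⇒≢ (proj₁ (inside d d<len)) ∘ sym)

    on-arc-next-not-min : ∀ {i} → OnArc i → h (next i) ≢ h lo
    on-arc-next-not-min (d , d≤len , reach) at-min with ℕP.m≤n⇒m<n∨m≡n d≤len
    ... | inj₁ d<len = ℤP.<⇒≢ (proj₁ (inside d d<len)) (sym (trans (cong (h ∘ next) reach) at-min))
    ... | inj₂ refl  = ℤP.<⇒≢ lo<hi (trans (sym at-min) (trans (cong (h ∘ next) (sym reach)) end-max))

  arc : Arc
  arc with reachable lo hi
  ... | zero  , lo≡hi    = contradiction (cong h lo≡hi) (ℤP.<⇒≢ lo<hi)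
  ... | suc d , reach-hi
    with a , L , at-min , at-max , clear ← segment (λ t → h ((next ^ t) lo) ℤP.≟ h lo)
                                                    (λ t → h ((next ^ t) lo) ℤP.≟ h hi)
                                                    refl d (cong h reach-hi)
    = record
    { start     = (next ^ a) lo
    ; len       = L
    ; start-min = at-min
    ; end-max   = trans (cong h (sym (shift L))) at-max
    ; inside    = λ t t<L →
        ℤP.≤∧≢⇒< (lo-min _) (λ eq → proj₁ (clear t t<L) (trans (cong h (shift t)) (sym eq))) ,
        ℤP.≤∧≢⇒< (hi-max _) (λ eq → proj₂ (clear t t<L) (trans (cong h (shift t)) eq))
    }
    where
    shift : ∀ t → (next ^ (suc t ℕ.+ a)) lo ≡ (next ^ suc t) ((next ^ a) lo)
    shift t = cong-app (^-homo next (suc t) a) lo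

module Orbit {A : Set} (f : A → A) (f-injective : Injective _≡_ _≡_ f)
             {K : ℕ} (code : A → Fin K) (code-injective : Injective _≡_ _≡_ code) where

  open import Function.Endo.Propositional A using (_^_; ^-homo)

  _≟_ : DecidableEquality A
  a ≟ b = map′ code-injective (cong code) (code a FP.≟ code b)

  ^-injective : ∀ d → Injective _≡_ _≡_ (f ^ d)
  ^-injective zero    eq = eq
  ^-injective (suc d) eq = ^-injective d (f-injective eq)

  repeat⇒return : ∀ a {s t} → s ℕ.< t → (f ^ s) a ≡ (f ^ t) a → (f ^ suc (t ℕ.∸ suc s)) a ≡ a
  repeat⇒return a {s} {t} s<t fˢa≡fᵗa = sym (^-injective s (begin
    (f ^ s) a                                  ≡⟨ fˢa≡fᵗa ⟩
    (f ^ t) a                                  ≡⟨ cong (λ d → (f ^ d) a) t≡s+d ⟨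
    (f ^ (s ℕ.+ suc (t ℕ.∸ suc s))) a          ≡⟨ cong-app (^-homo f s _) a ⟩
    (f ^ s) ((f ^ suc (t ℕ.∸ suc s)) a)        ∎))
    where
    open ≡-Reasoning
    t≡s+d : s ℕ.+ suc (t ℕ.∸ suc s) ≡ t
    t≡s+d = trans (ℕP.+-suc s _) (ℕP.m+[n∸m]≡n s<t)

  Returns : A → ℕ → Set
  Returns a d = (f ^ suc d) a ≡ a

  eventually-returns : ∀ a → ∃[ d ] d ℕ.< K × Returns a d
  eventually-returns a with FP.pigeonhole (ℕP.n<1+n K) (λ (t : Fin (suc K)) → code ((f ^ toℕ t) a))
  ... | s , t , s<t , same =
    toℕ t ℕ.∸ suc (toℕ s) ,
    ℕP.<-≤-trans (ℕP.∸-monoʳ-< {toℕ t} {suc (toℕ s)} {0} ℕ.z<s s<t) (FP.toℕ≤pred[n] t) ,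
    repeat⇒return a s<t (code-injective same)

  first-return : ∀ a → ∃[ t ] Returns a (toℕ t) × (∀ (j : F.Fin′ t) → ¬ Returns a (toℕ (inject j)))
  first-return a with d , d<K , returns-d ← eventually-returns a
    with t , ¬¬returns , earlier ← FP.¬∀⟶∃¬-smallest K (λ t → ¬ Returns a (toℕ t)) (λ t → ¬? (_ ≟ a))
                                     (λ never → never (fromℕ< d<K) (subst (Returns a) (sym (FP.toℕ-fromℕ< d<K)) returns-d))
    = t , decidable-stable (_ ≟ a) ¬¬returns , earlier

  record Cycle (a : A) : Set where
    field
      len             : ℕ
      point           : Fin (suc len) → A
      point-zero      : point zero ≡ a
      point-next      : ∀ t → point (next t) ≡ f (point t)
      point-injective : Injective _≡_ _≡_ point

  cycle : ∀ a → Cycle a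
  cycle a with t , returns-t , earlier ← first-return a = record
    { len             = toℕ t
    ; point           = point
    ; point-zero      = refl
    ; point-next      = point-next
    ; point-injective = point-injective
    }
    where
    point : Fin (suc (toℕ t)) → A
    point s = (f ^ toℕ s) a
    point-next : ∀ s → point (next s) ≡ f (point s)
    point-next s with position s
    ... | below-last s<t = cong (λ e → (f ^ e) a) (toℕ-next s s<t)
    ... | at-last s≡t = begin
      point (next s)            ≡⟨ cong point (next-last s s≡t) ⟩
      a                         ≡⟨ returns-t ⟨
      (f ^ suc (toℕ t)) a       ≡⟨ cong (λ e → (f ^ suc e) a) s≡t ⟨
      f (point s)               ∎
      where open ≡-Reasoning
    no-early-return : ∀ {s u : Fin (suc (toℕ t))} → toℕ s ℕ.< toℕ u → point s ≢ point u
    no-early-return {s} {u} s<u eq = earlier j (subst (Returns a) (sym toℕ-j) (repeat⇒return a s<u eq))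
      where
      d<t : toℕ u ℕ.∸ suc (toℕ s) ℕ.< toℕ t
      d<t = ℕP.<-≤-trans (ℕP.∸-monoʳ-< {toℕ u} {suc (toℕ s)} {0} ℕ.z<s s<u) (FP.toℕ≤pred[n] u)
      j = fromℕ< d<t
      toℕ-j : toℕ (inject j) ≡ toℕ u ℕ.∸ suc (toℕ s)
      toℕ-j = trans (FP.toℕ-inject j) (FP.toℕ-fromℕ< d<t)
    point-injective : Injective _≡_ _≡_ point
    point-injective {s} {u} eq with ℕP.<-cmp (toℕ s) (toℕ u)
    ... | tri< s<u _ _ = contradiction eq (no-early-return s<u)
    ... | tri≈ _ s≡u _ = FP.toℕ-injective s≡u
    ... | tri> _ _ u<s = contradiction (sym eq) (no-early-return u<s)

module Stitches (m n : ℕ) (x : Fin (suc n) → Sign) (y : Fin (suc m) → Sign) where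

  open Cloth m n x y

  out-H : Vertex m n → Edge m n
  out-H (i , j) with x j
  ... | Sign.+ = H i j
  ... | Sign.- = H (prev i) j

  out-V : Vertex m n → Edge m n
  out-V (i , j) with y i
  ... | Sign.+ = V i j
  ... | Sign.- = V i (prev j)

  in-H : Vertex m n → Edge m n
  in-H (i , j) with x j
  ... | Sign.+ = H (prev i) j
  ... | Sign.- = H i j

  in-V : Vertex m n → Edge m n
  in-V (i , j) with y i
  ... | Sign.+ = V i (prev j)
  ... | Sign.- = V i j

  tl-out-H : ∀ v → tl (out-H v) ≡ v
  tl-out-H (i , j) with x j in xj
  ... | Sign.+ rewrite xj = refl
  ... | Sign.- rewrite xj = cong (_, j) (next-prev i)

  tl-out-V : ∀ v → tl (out-V v) ≡ v
  tl-out-V (i , j) with y i in yi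
  ... | Sign.+ rewrite yi = refl
  ... | Sign.- rewrite yi = cong (i ,_) (next-prev j)

  out-H-tl : ∀ i j → out-H (tl (H i j)) ≡ H i j
  out-H-tl i j with x j in xj
  ... | Sign.+ rewrite xj = refl
  ... | Sign.- rewrite xj = cong (λ a → H a j) (prev-next i)

  out-V-tl : ∀ i j → out-V (tl (V i j)) ≡ V i j
  out-V-tl i j with y i in yi
  ... | Sign.+ rewrite yi = refl
  ... | Sign.- rewrite yi = cong (V i) (prev-next j)

  in-H-hd : ∀ i j → in-H (hd (H i j)) ≡ H i j
  in-H-hd i j with x j in xj
  ... | Sign.+ rewrite xj = cong (λ a → H a j) (prev-next i)
  ... | Sign.- rewrite xj = refl

  in-V-hd : ∀ i j → in-V (hd (V i j)) ≡ V i j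
  in-V-hd i j with y i in yi
  ... | Sign.+ rewrite yi = cong (V i) (prev-next j)
  ... | Sign.- rewrite yi = refl

  isH-out-H : ∀ v → isH (out-H v) ≡ true
  isH-out-H (i , j) with x j
  ... | Sign.+ = refl
  ... | Sign.- = refl

  isH-out-V : ∀ v → isH (out-V v) ≡ false
  isH-out-V (i , j) with y i
  ... | Sign.+ = refl
  ... | Sign.- = refl

  row-hd-H : ∀ i j → proj₂ (hd (H i j)) ≡ j
  row-hd-H i j with x j
  ... | Sign.+ = refl
  ... | Sign.- = refl

  row-tl-H : ∀ i j → proj₂ (tl (H i j)) ≡ j
  row-tl-H i j with x j
  ... | Sign.+ = refl
  ... | Sign.- = refl

  column-hd-V : ∀ i j → proj₁ (hd (V i j)) ≡ i
  column-hd-V i j with y i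
  ... | Sign.+ = refl
  ... | Sign.- = refl

  step : Edge m n → Edge m n
  step (H i j) = out-V (hd (H i j))
  step (V i j) = out-H (hd (V i j))

  hd≡tl-step : ∀ e → hd e ≡ tl (step e)
  hd≡tl-step (H i j) = sym (tl-out-V _)
  hd≡tl-step (V i j) = sym (tl-out-H _)

  isH-step : ∀ e → isH (step e) ≡ not (isH e)
  isH-step (H i j) = isH-out-V _
  isH-step (V i j) = isH-out-H _

  step-injective : Injective _≡_ _≡_ step
  step-injective {H i j} {H i′ j′} eq = begin
    H i j              ≡⟨ in-H-hd i j ⟨
    in-H (hd (H i j))  ≡⟨ cong in-H (trans (sym (tl-out-V _)) (trans (cong tl eq) (tl-out-V _))) ⟩
    in-H (hd (H i′ j′)) ≡⟨ in-H-hd i′ j′ ⟩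
    H i′ j′            ∎
    where open ≡-Reasoning
  step-injective {V i j} {V i′ j′} eq = begin
    V i j              ≡⟨ in-V-hd i j ⟨
    in-V (hd (V i j))  ≡⟨ cong in-V (trans (sym (tl-out-H _)) (trans (cong tl eq) (tl-out-H _))) ⟩
    in-V (hd (V i′ j′)) ≡⟨ in-V-hd i′ j′ ⟩
    V i′ j′            ∎
    where open ≡-Reasoning
  step-injective {H i j} {V i′ j′} eq with () ← trans (sym (isH-step (H i j))) (trans (cong isH eq) (isH-step (V i′ j′)))
  step-injective {V i j} {H i′ j′} eq with () ← trans (sym (isH-step (V i j))) (trans (cong isH eq) (isH-step (H i′ j′)))

  step-unique : ∀ e e′ → hd e ≡ tl e′ → isH e ≢ isH e′ → e′ ≡ step e
  step-unique (H i j) (V i′ j′) hd≡tl _ = trans (sym (out-V-tl i′ j′)) (cong out-V (sym hd≡tl))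
  step-unique (V i j) (H i′ j′) hd≡tl _ = trans (sym (out-H-tl i′ j′)) (cong out-H (sym hd≡tl))
  step-unique (H i j) (H i′ j′) _ alt = contradiction refl alt
  step-unique (V i j) (V i′ j′) _ alt = contradiction refl alt

  edge-next : ∀ (ℓ : Loop) t → edge ℓ (next t) ≡ step (edge ℓ t)
  edge-next ℓ t = step-unique (edge ℓ t) (edge ℓ (next t)) (link ℓ t) (alt ℓ t)

  code : Edge m n → Fin (suc m ℕ.* suc n ℕ.+ suc m ℕ.* suc n)
  code (H i j) = F.join (suc m ℕ.* suc n) _ (inj₁ (F.combine i j))
  code (V i j) = F.join (suc m ℕ.* suc n) _ (inj₂ (F.combine i j))

  unsplit : Fin (suc m ℕ.* suc n) ⊎ Fin (suc m ℕ.* suc n) → Edge m n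
  unsplit = [ uncurry H ∘ F.remQuot (suc n) , uncurry V ∘ F.remQuot (suc n) ]′

  decode-code : ∀ e → unsplit (F.splitAt (suc m ℕ.* suc n) (code e)) ≡ e
  decode-code (H i j) = trans (cong unsplit (FP.splitAt-join (suc m ℕ.* suc n) _ (inj₁ (F.combine i j))))
                              (cong (uncurry H) (FP.remQuot-combine i j))
  decode-code (V i j) = trans (cong unsplit (FP.splitAt-join (suc m ℕ.* suc n) _ (inj₂ (F.combine i j))))
                              (cong (uncurry V) (FP.remQuot-combine i j))

  code-injective : Injective _≡_ _≡_ code
  code-injective {e} {e′} eq = trans (sym (decode-code e)) (trans (cong (unsplit ∘ F.splitAt (suc m ℕ.* suc n)) eq) (decode-code e′))

  loop-through : ∀ e → ∃[ ℓ ] edge ℓ zero ≡ e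
  loop-through e = record
    { len  = cycle-len
    ; edge = point
    ; link = λ t → trans (hd≡tl-step (point t)) (cong tl (sym (point-next t)))
    ; alt  = λ t → subst (isH (point t) ≢_) (trans (sym (isH-step (point t))) (cong isH (sym (point-next t))))
                     (not-¬ refl)
    ; circ = point-injective
    } , point-zero
    where open Orbit.Cycle (Orbit.cycle step step-injective code code-injective e) renaming (len to cycle-len)

module Transpose (m n : ℕ) (x : Fin (suc n) → Sign) (y : Fin (suc m) → Sign) where

  private
    module A = Cloth n m y x
    module B = Cloth m n x y

  transpose : Edge n m → Edge m n
  transpose (H i j) = V j i
  transpose (V i j) = H j i

  tl-transpose : ∀ e → B.tl (transpose e) ≡ swap (A.tl e)
  tl-transpose (H i j) with y j
  ... | Sign.+ = refl
  ... | Sign.- = refl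
  tl-transpose (V i j) with x i
  ... | Sign.+ = refl
  ... | Sign.- = refl

  hd-transpose : ∀ e → B.hd (transpose e) ≡ swap (A.hd e)
  hd-transpose (H i j) with y j
  ... | Sign.+ = refl
  ... | Sign.- = refl
  hd-transpose (V i j) with x i
  ... | Sign.+ = refl
  ... | Sign.- = refl

  isH-transpose : ∀ e → isH (transpose e) ≡ not (isH e)
  isH-transpose (H i j) = refl
  isH-transpose (V i j) = refl

  transpose-injective : Injective _≡_ _≡_ transpose
  transpose-injective {H i j} {H i′ j′} refl = refl
  transpose-injective {V i j} {V i′ j′} refl = refl

  transpose-loop : A.Loop → B.Loop
  transpose-loop ℓ = record
    { len  = A.len ℓ
    ; edge = transpose ∘ A.edge ℓ
    ; link = λ t → trans (hd-transpose (A.edge ℓ t))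
                     (trans (cong swap (A.link ℓ t)) (sym (tl-transpose (A.edge ℓ (next t)))))
    ; alt  = λ t eq → A.alt ℓ t (not-injective (trans (sym (isH-transpose _)) (trans eq (isH-transpose _))))
    ; circ = λ eq → A.circ ℓ (transpose-injective eq)
    }

  Δx-transpose : ∀ ℓ → B.Δx (transpose-loop ℓ) ≡ A.Δy ℓ
  Δx-transpose ℓ = sumFin-cong (λ t → dx-transpose (A.edge ℓ t))
    where
    dx-transpose : ∀ e → B.dx (transpose e) ≡ A.dy e
    dx-transpose (H i j) = refl
    dx-transpose (V i j) = refl

  Δy-transpose : ∀ ℓ → B.Δy (transpose-loop ℓ) ≡ A.Δx ℓ
  Δy-transpose ℓ = sumFin-cong (λ t → dy-transpose (A.edge ℓ t))
    where
    dy-transpose : ∀ e → B.dy (transpose e) ≡ A.dx e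
    dy-transpose (H i j) = refl
    dy-transpose (V i j) = refl

module Reverse (m n : ℕ) (x : Fin (suc n) → Sign) (y : Fin (suc m) → Sign) where

  private
    module A = Cloth m n (neg x) (neg y)
    module B = Cloth m n x y

  hd≡tl : ∀ e → B.hd e ≡ A.tl e
  hd≡tl (H i j) with x j
  ... | Sign.+ = refl
  ... | Sign.- = refl
  hd≡tl (V i j) with y i
  ... | Sign.+ = refl
  ... | Sign.- = refl

  tl≡hd : ∀ e → B.tl e ≡ A.hd e
  tl≡hd (H i j) with x j
  ... | Sign.+ = refl
  ... | Sign.- = refl
  tl≡hd (V i j) with y i
  ... | Sign.+ = refl
  ... | Sign.- = refl

  reverse-loop : A.Loop → B.Loop
  reverse-loop ℓ = record
    { len  = A.len ℓ
    ; edge = E ∘ opposite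
    ; link = λ t → begin
        B.hd (E (opposite t))                ≡⟨ hd≡tl (E (opposite t)) ⟩
        A.tl (E (opposite t))                ≡⟨ cong (A.tl ∘ E) (next-opposite t) ⟨
        A.tl (E (next (opposite (next t))))  ≡⟨ A.link ℓ (opposite (next t)) ⟨
        A.hd (E (opposite (next t)))         ≡⟨ tl≡hd (E (opposite (next t))) ⟨
        B.tl (E (opposite (next t)))         ∎
    ; alt  = λ t eq → A.alt ℓ (opposite (next t)) (trans (sym eq) (cong (isH ∘ E) (sym (next-opposite t))))
    ; circ = λ {s} {t} eq → begin
        s                        ≡⟨ FP.opposite-involutive s ⟨
        opposite (opposite s)    ≡⟨ cong opposite (A.circ ℓ eq) ⟩
        opposite (opposite t)    ≡⟨ FP.opposite-involutive t ⟩
        t                        ∎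
    }
    where
    open ≡-Reasoning
    E = A.edge ℓ

  Δx-reverse : ∀ ℓ → B.Δx (reverse-loop ℓ) ≡ - A.Δx ℓ
  Δx-reverse ℓ = begin
    sumFin _ (B.dx ∘ E ∘ opposite)  ≡⟨ sumFin≡sum _ (B.dx ∘ E ∘ opposite) ⟩
    sum (B.dx ∘ E ∘ opposite)       ≡⟨ ∑-reverse (B.dx ∘ E) ⟩
    sum (B.dx ∘ E)                  ≡⟨ sum-cong-≗ (dx-neg ∘ E) ⟩
    sum (-_ ∘ A.dx ∘ E)             ≡⟨ ∑-neg (A.dx ∘ E) ⟩
    - sum (A.dx ∘ E)                ≡⟨ cong -_ (sumFin≡sum _ (A.dx ∘ E)) ⟨
    - A.Δx ℓ                        ∎
    where
    open ≡-Reasoning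
    E = A.edge ℓ
    dx-neg : ∀ e → B.dx e ≡ - A.dx e
    dx-neg (H i j) = trans (sym (ℤP.neg-involutive _)) (cong -_ (sym (val-opposite (x j))))
    dx-neg (V i j) = refl

  Δy-reverse : ∀ ℓ → B.Δy (reverse-loop ℓ) ≡ - A.Δy ℓ
  Δy-reverse ℓ = begin
    sumFin _ (B.dy ∘ E ∘ opposite)  ≡⟨ sumFin≡sum _ (B.dy ∘ E ∘ opposite) ⟩
    sum (B.dy ∘ E ∘ opposite)       ≡⟨ ∑-reverse (B.dy ∘ E) ⟩
    sum (B.dy ∘ E)                  ≡⟨ sum-cong-≗ (dy-neg ∘ E) ⟩
    sum (-_ ∘ A.dy ∘ E)             ≡⟨ ∑-neg (A.dy ∘ E) ⟩
    - sum (A.dy ∘ E)                ≡⟨ cong -_ (sumFin≡sum _ (A.dy ∘ E)) ⟨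
    - A.Δy ℓ                        ∎
    where
    open ≡-Reasoning
    E = A.edge ℓ
    dy-neg : ∀ e → B.dy e ≡ - A.dy e
    dy-neg (H i j) = refl
    dy-neg (V i j) = trans (sym (ℤP.neg-involutive _)) (cong -_ (sym (val-opposite (y i))))

module Crossing (m n : ℕ) (x : Fin (suc n) → Sign) (y : Fin (suc m) → Sign) (c : Fin (suc n)) where

  open Cloth m n x y
  open Stitches m n x y using (row-hd-H; row-tl-H)

  crossing : Edge m n → ℤ
  crossing (H i j) = + 0
  crossing (V i j) = if does (j FP.≟ c) then val (y i) else + 0

  crossing-cut : ∀ i → crossing (V i c) ≡ val (y i)
  crossing-cut i with c FP.≟ c
  ... | yes _   = refl
  ... | no c≢c = contradiction refl c≢c

  -- Row indices lifted to ℤ so that the lift goes up by one from each row to the next, except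
  -- from row c to row next c; hence dy telescopes along a loop up to N times its crossings.
  lift : ℕ → ℤ
  lift t with t ℕ.≤? toℕ c
  ... | yes _ = + (t ℕ.+ suc n)
  ... | no _  = + t

  lift-suc : ∀ t → t ≢ toℕ c → lift (suc t) ≡ lift t + + 1
  lift-suc t t≢c with suc t ℕ.≤? toℕ c | t ℕ.≤? toℕ c
  ... | yes _     | yes _   = cong +_ (ℕP.+-comm 1 (t ℕ.+ suc n))
  ... | yes t<c   | no t≰c  = contradiction (ℕP.<⇒≤ t<c) t≰c
  ... | no  t≮c   | yes t≤c = contradiction (ℕP.≤∧≢⇒< t≤c t≢c) t≮c
  ... | no  _     | no _    = cong +_ (ℕP.+-comm 1 t)

  lift-suc-cut : lift (suc (toℕ c)) + + suc n ≡ lift (toℕ c) + + 1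
  lift-suc-cut with suc (toℕ c) ℕ.≤? toℕ c | toℕ c ℕ.≤? toℕ c
  ... | yes c<c | _      = contradiction c<c (ℕP.<-irrefl refl)
  ... | no _    | yes _  = cong +_ (ℕP.+-comm 1 (toℕ c ℕ.+ suc n))
  ... | no _    | no c≰c = contradiction ℕP.≤-refl c≰c

  row-lift : Fin (suc n) → ℤ
  row-lift j = lift (toℕ j)

  lift-zero : lift 0 ≡ + suc n
  lift-zero with 0 ℕ.≤? toℕ c
  ... | yes _  = refl
  ... | no 0≰c = contradiction z≤n 0≰c

  lift-above : ∀ t → toℕ c ℕ.< t → lift t ≡ + t
  lift-above t c<t with t ℕ.≤? toℕ c
  ... | yes t≤c = contradiction t≤c (ℕP.<⇒≱ c<t)
  ... | no _    = refl

  row-lift-next : ∀ j → j ≢ c → row-lift (next j) ≡ row-lift j + + 1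
  row-lift-next j j≢c with position j
  ... | below-last j<n = trans (cong lift (toℕ-next j j<n)) (lift-suc (toℕ j) (j≢c ∘ FP.toℕ-injective))
  ... | at-last j≡n = begin
    row-lift (next j)   ≡⟨ cong row-lift (next-last j j≡n) ⟩
    lift 0              ≡⟨ lift-zero ⟩
    + suc n             ≡⟨ cong +_ (trans (ℕP.+-comm (toℕ j) 1) (cong suc j≡n)) ⟨
    + toℕ j + + 1       ≡⟨ cong (_+ + 1) (lift-above (toℕ j) c<j) ⟨
    row-lift j + + 1    ∎
    where
    open ≡-Reasoning
    c<j : toℕ c ℕ.< toℕ j
    c<j = ℕP.≤∧≢⇒< (subst (toℕ c ℕ.≤_) (sym j≡n) (FP.toℕ≤pred[n] c)) (j≢c ∘ FP.toℕ-injective ∘ sym)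

  row-lift-next-cut : row-lift (next c) + + suc n ≡ row-lift c + + 1
  row-lift-next-cut with position c
  ... | below-last c<n = trans (cong (λ t → lift t + + suc n) (toℕ-next c c<n)) lift-suc-cut
  ... | at-last c≡n = begin
    row-lift (next c) + + suc n    ≡⟨ cong (λ j → row-lift j + + suc n) (next-last c c≡n) ⟩
    lift 0 + + suc n               ≡⟨ cong (_+ + suc n) lift-zero ⟩
    + (suc n ℕ.+ suc n)            ≡⟨ cong (λ t → + (suc t ℕ.+ suc n)) c≡n ⟨
    + (suc (toℕ c) ℕ.+ suc n)      ≡⟨ cong +_ (ℕP.+-comm 1 (toℕ c ℕ.+ suc n)) ⟩
    + (toℕ c ℕ.+ suc n) + + 1      ≡⟨ cong (_+ + 1) lift-c ⟨
    row-lift c + + 1               ∎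
    where
    open ≡-Reasoning
    lift-c : lift (toℕ c) ≡ + (toℕ c ℕ.+ suc n)
    lift-c with toℕ c ℕ.≤? toℕ c
    ... | yes _  = refl
    ... | no c≰c = contradiction ℕP.≤-refl c≰c

  across : row-lift c ≡ row-lift (next c) + + suc n - + 1
  across = trans (sym (cancel (row-lift c))) (cong (_- + 1) (sym row-lift-next-cut))
    where
    cancel : ∀ b → b + + 1 - + 1 ≡ b
    cancel = solve-∀

  dy≡Δrow-lift : ∀ e → dy e ≡ row-lift (proj₂ (hd e)) - row-lift (proj₂ (tl e)) + + suc n * crossing e
  dy≡Δrow-lift (H i j) rewrite row-hd-H i j | row-tl-H i j =
    sym (trans (cong (_+ + suc n * + 0) (ℤP.+-inverseʳ (row-lift j))) (trans (ℤP.+-identityˡ _) (ℤP.*-zeroʳ (+ suc n))))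
  dy≡Δrow-lift (V i j) with j FP.≟ c | y i
  ... | yes refl | Sign.+ = trans (up (row-lift (next c)) (+ suc n)) (cong (λ b → row-lift (next c) - b + + suc n * + 1) (sym across))
    where
    up : ∀ a N → + 1 ≡ a - (a + N - + 1) + N * + 1
    up = solve-∀
  ... | yes refl | Sign.- = trans (down (row-lift (next c)) (+ suc n)) (cong (λ b → b - row-lift (next c) + + suc n * - + 1) (sym across))
    where
    down : ∀ a N → - + 1 ≡ (a + N - + 1) - a + N * - + 1
    down = solve-∀
  ... | no j≢c   | Sign.+ = trans (up (row-lift j) (+ suc n)) (cong (λ a → a - row-lift j + + suc n * + 0) (sym (row-lift-next j j≢c)))
    where
    up : ∀ b N → + 1 ≡ (b + + 1) - b + N * + 0
    up = solve-∀
  ... | no j≢c   | Sign.- = trans (down (row-lift j) (+ suc n)) (cong (λ a → row-lift j - a + + suc n * + 0) (sym (row-lift-next j j≢c)))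
    where
    down : ∀ b N → - + 1 ≡ b - (b + + 1) + N * + 0
    down = solve-∀

  Δy≡crossings : ∀ (ℓ : Loop) → Δy ℓ ≡ + suc n * sum (crossing ∘ edge ℓ)
  Δy≡crossings ℓ = begin
    Δy ℓ                                                        ≡⟨ sumFin≡sum _ (dy ∘ E) ⟩
    sum (dy ∘ E)                                                ≡⟨ sum-cong-≗ decompose ⟩
    sum (λ t → (g (next t) - g t) + + suc n * crossing (E t))   ≡⟨ ∑-distrib-+ (λ t → g (next t) - g t) (λ t → + suc n * crossing (E t)) ⟩
    sum (λ t → g (next t) - g t) + sum (λ t → + suc n * crossing (E t))
                                                                ≡⟨ cong₂ _+_ (∑-telescope g) (sym (*-distribˡ-sum (+ suc n) (crossing ∘ E))) ⟩
    + 0 + + suc n * sum (crossing ∘ E)                          ≡⟨ ℤP.+-identityˡ _ ⟩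
    + suc n * sum (crossing ∘ E)                                ∎
    where
    open ≡-Reasoning
    E = edge ℓ
    g : Fin (suc (len ℓ)) → ℤ
    g t = row-lift (proj₂ (tl (E t)))
    decompose : ∀ t → dy (E t) ≡ (g (next t) - g t) + + suc n * crossing (E t)
    decompose t = trans (dy≡Δrow-lift (E t)) (cong (λ v → row-lift (proj₂ v) - g t + + suc n * crossing (E t)) (link ℓ t))

module Levels (m n : ℕ) (x : Fin (suc n) → Sign) (y : Fin (suc m) → Sign)
              {rx ry : ℤ} (X : Profile x rx) (Y : Profile y ry) where

  open Cloth m n x y
  open Stitches m n x y

  private
    module X = Profile X
    module Y = Profile Y

  H-row : Fin (suc n) → Fin (suc n)
  H-row j with x j
  ... | Sign.+ = next j
  ... | Sign.- = j

  V-column : Fin (suc m) → Fin (suc m)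
  V-column i with y i
  ... | Sign.+ = i
  ... | Sign.- = next i

  -- The upper-right corner of the face on the left of an edge, in its orientation.
  corner : Edge m n → Vertex m n
  corner (H i j) = next i , H-row j
  corner (V i j) = V-column i , next j

  height : Vertex m n → ℤ
  height (i , j) = X.walk j - Y.walk i

  level : Edge m n → ℤ
  level = height ∘ corner

  up≡right : ∀ {i j} → val (x j) ≡ - val (y i) → height (i , next j) ≡ height (next i , j)
  up≡right {i} {j} xⱼ≡-yᵢ = begin
    X.walk (next j) - Y.walk i                 ≡⟨ cong (_- Y.walk i) (X.walk-next j) ⟩
    X.walk j + val (x j) - Y.walk i            ≡⟨ cong (λ v → X.walk j + v - Y.walk i) xⱼ≡-yᵢ ⟩
    X.walk j + - val (y i) - Y.walk i          ≡⟨ regroup (X.walk j) (val (y i)) (Y.walk i) ⟩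
    X.walk j - (Y.walk i + val (y i))          ≡⟨ cong (_-_ (X.walk j)) (Y.walk-next i) ⟨
    X.walk j - Y.walk (next i)                 ∎
    where
    open ≡-Reasoning
    regroup : ∀ a s b → a + - s - b ≡ a - (b + s)
    regroup = solve-∀

  diagonal≡ : ∀ {i j} → val (x j) ≡ val (y i) → height (next i , next j) ≡ height (i , j)
  diagonal≡ {i} {j} xⱼ≡yᵢ = begin
    X.walk (next j) - Y.walk (next i)                  ≡⟨ cong₂ _-_ (X.walk-next j) (Y.walk-next i) ⟩
    X.walk j + val (x j) - (Y.walk i + val (y i))      ≡⟨ cong (λ v → X.walk j + v - (Y.walk i + val (y i))) xⱼ≡yᵢ ⟩
    X.walk j + val (y i) - (Y.walk i + val (y i))      ≡⟨ cancel (X.walk j) (val (y i)) (Y.walk i) ⟩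
    X.walk j - Y.walk i                                ∎
    where
    open ≡-Reasoning
    cancel : ∀ a s b → a + s - (b + s) ≡ a - b
    cancel = solve-∀

  opposite-signs : ∀ {s t u} → s ≡ u → t ≡ Sign.opposite u → val s ≡ - val t
  opposite-signs {u = Sign.+} refl refl = refl
  opposite-signs {u = Sign.-} refl refl = refl

  level-out-V : ∀ v → level (out-V v) ≡ level (in-H v)
  level-out-V (i , j) with x j in xⱼ | y i in yᵢ
  ... | Sign.+ | Sign.+ rewrite xⱼ | yᵢ = cong (λ a → height (a , next j)) (sym (next-prev i))
  ... | Sign.+ | Sign.- rewrite xⱼ | yᵢ =
    trans (cong (λ b → height (next i , b)) (next-prev j))
          (trans (sym (up≡right (opposite-signs xⱼ yᵢ)))
                 (cong (λ a → height (a , next j)) (sym (next-prev i))))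
  ... | Sign.- | Sign.+ rewrite xⱼ | yᵢ = up≡right (opposite-signs xⱼ yᵢ)
  ... | Sign.- | Sign.- rewrite xⱼ | yᵢ = cong (λ b → height (next i , b)) (next-prev j)

  level-out-H : ∀ v → level (out-H v) ≡ level (in-V v)
  level-out-H (i , j) with x j in xⱼ | y i in yᵢ
  ... | Sign.+ | Sign.+ rewrite xⱼ | yᵢ =
    trans (diagonal≡ (cong val (trans xⱼ (sym yᵢ)))) (cong (λ b → height (i , b)) (sym (next-prev j)))
  ... | Sign.+ | Sign.- rewrite xⱼ | yᵢ = refl
  ... | Sign.- | Sign.+ rewrite xⱼ | yᵢ = cong₂ (λ a b → height (a , b)) (next-prev i) (sym (next-prev j))
  ... | Sign.- | Sign.- rewrite xⱼ | yᵢ =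
    trans (cong (λ a → height (a , j)) (next-prev i)) (sym (diagonal≡ (cong val (trans xⱼ (sym yᵢ)))))

  level-step : ∀ e → level (step e) ≡ level e
  level-step (H i j) = trans (level-out-V (hd (H i j))) (cong level (in-H-hd i j))
  level-step (V i j) = trans (level-out-H (hd (V i j))) (cong level (in-V-hd i j))

  level-loop : ∀ (ℓ : Loop) t → level (edge ℓ t) ≡ level (edge ℓ zero)
  level-loop ℓ = cyclic-induction (λ t → level (edge ℓ t) ≡ level (edge ℓ zero)) refl
    (λ t eq → trans (cong level (edge-next ℓ t)) (trans (level-step (edge ℓ t)) eq))

  level-V : ∀ i j → level (V i (prev j)) ≡ X.walk j - Y.walk (V-column i)
  level-V i j = cong (λ b → X.walk b - Y.walk (V-column i)) (next-prev j)

  V-column-below-max : ∀ i → Y.walk (V-column i) < Y.walk Y.hi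
  V-column-below-max i with y i in yᵢ
  ... | Sign.+ = ℤP.<-≤-trans (ascent Y yᵢ) (Y.hi-max (next i))
  ... | Sign.- = ℤP.<-≤-trans (descent Y yᵢ) (Y.hi-max i)

  H-row-above-min : ∀ j → X.walk X.lo < X.walk (H-row j)
  H-row-above-min j with x j in xⱼ
  ... | Sign.+ = ℤP.≤-<-trans (X.lo-min j) (ascent X xⱼ)
  ... | Sign.- = ℤP.≤-<-trans (X.lo-min (next j)) (descent X xⱼ)

  no-crossing : ∀ (ℓ : Loop) c → (∀ i → level (V i c) ≢ level (edge ℓ zero)) → Δy ℓ ≡ + 0
  no-crossing ℓ c avoids = begin
    Δy ℓ                                   ≡⟨ Δy≡crossings ℓ ⟩
    + suc n * sum (crossing ∘ edge ℓ)      ≡⟨ cong (+ suc n *_) (trans (sum-cong-≗ uncrossed) (sum-replicate-zero (suc (len ℓ)))) ⟩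
    + suc n * + 0                          ≡⟨ ℤP.*-zeroʳ (+ suc n) ⟩
    + 0                                    ∎
    where
    open ≡-Reasoning
    open Crossing m n x y c
    uncrossed : ∀ t → crossing (edge ℓ t) ≡ + 0
    uncrossed t with edge ℓ t in eₜ
    ... | H i j = refl
    ... | V i j with j FP.≟ c
    ...   | no _     = refl
    ...   | yes refl = contradiction (trans (cong level (sym eₜ)) (level-loop ℓ t)) (avoids i)

  lo-lo≤hi-hi : ry ≤ rx → X.walk X.lo - Y.walk Y.lo ≤ X.walk X.hi - Y.walk Y.hi
  lo-lo≤hi-hi ry≤rx = ≤-translate (X.walk X.lo - Y.walk Y.hi) (subst₂ _≤_ (sym Y.hi-lo) (sym X.hi-lo) ry≤rx)
    (regroup₁ (Y.walk Y.hi) (Y.walk Y.lo) (X.walk X.lo)) (regroup₂ (X.walk X.hi) (X.walk X.lo) (Y.walk Y.hi))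
    where
    regroup₁ : ∀ a b c → a - b + (c - a) ≡ c - b
    regroup₁ = solve-∀
    regroup₂ : ∀ a b c → a - b + (b - c) ≡ a - c
    regroup₂ = solve-∀

  no-vertical-winding : ry ≤ rx → ∀ (ℓ : Loop) → Δy ℓ ≡ + 0
  no-vertical-winding ry≤rx ℓ with level (edge ℓ zero) ℤP.≤? X.walk X.hi - Y.walk Y.hi
  ... | yes v≤ = no-crossing ℓ (prev X.hi) λ i eq →
    ℤP.<⇒≱ (subst (X.walk X.hi - Y.walk Y.hi <_) (sym (level-V i X.hi))
              (ℤP.+-monoʳ-< (X.walk X.hi) (ℤP.neg-mono-< (V-column-below-max i))))
           (subst (_≤ X.walk X.hi - Y.walk Y.hi) (sym eq) v≤)
  ... | no v≰ = no-crossing ℓ (prev X.lo) λ i eq → v≰ (subst (_≤ X.walk X.hi - Y.walk Y.hi) eq (begin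
    level (V i (prev X.lo))            ≡⟨ level-V i X.lo ⟩
    X.walk X.lo - Y.walk (V-column i)  ≤⟨ ℤP.+-monoʳ-≤ (X.walk X.lo) (ℤP.neg-mono-≤ (Y.lo-min (V-column i))) ⟩
    X.walk X.lo - Y.walk Y.lo          ≤⟨ lo-lo≤hi-hi ry≤rx ⟩
    X.walk X.hi - Y.walk Y.hi          ∎))
    where open ℤP.≤-Reasoning

  V-column-ascent : ∀ {i} → y i ≡ Sign.+ → V-column i ≡ i
  V-column-ascent yᵢ≡+ rewrite yᵢ≡+ = refl

  module Upward (rx<ry : rx < ry) where

    cut : Fin (suc n)
    cut = prev X.lo

    v : ℤ
    v = X.walk X.lo - Y.walk Y.lo

    open Arcs Y.range (0<r⇒lo<hi Y.range (ℤP.≤-<-trans (0≤r X.range) rx<ry))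

    module Along (γ : Arc) where

      open Arc γ

      -- Horizontal edges of level v join only columns where min B < B < max B (H-between),
      -- so following a loop of level v never leaves the arc.
      Good : Edge m n → Set
      Good e = level e ≡ v × OnArc (proj₁ (hd e))

      H-between : ∀ i j → level (H i j) ≡ v → Y.walk Y.lo < Y.walk (next i) × Y.walk (next i) < Y.walk Y.hi
      H-between i j level≡v = between (H-row-above-min j) (X.hi-max (H-row j)) level≡v
                                      (subst₂ _<_ (sym X.hi-lo) (sym Y.hi-lo) rx<ry)

      move-H : ∀ i j → Y.walk Y.lo < Y.walk (next i) × Y.walk (next i) < Y.walk Y.hi →
               OnArc (proj₁ (tl (H i j))) → OnArc (proj₁ (hd (H i j)))
      move-H i j (above , below) with x j
      ... | Sign.+ = λ on → on-arc-right on below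
      ... | Sign.- = λ on → on-arc-left on above

      move-V : ∀ i j → OnArc (proj₁ (tl (V i j))) → OnArc (proj₁ (hd (V i j)))
      move-V i j with y i
      ... | Sign.+ = λ on → on
      ... | Sign.- = λ on → on

      good-step : ∀ e → Good e → Good (step e)
      good-step e (level≡v , on) = level-step′ , move (step e) level-step′ (subst (OnArc ∘ proj₁) (hd≡tl-step e) on)
        where
        level-step′ : level (step e) ≡ v
        level-step′ = trans (level-step e) level≡v
        move : ∀ e → level e ≡ v → OnArc (proj₁ (tl e)) → OnArc (proj₁ (hd e))
        move (H i j) level≡v = move-H i j (H-between i j level≡v)
        move (V i j) _       = move-V i j

      V-column-min : ∀ i → OnArc i → Y.walk (V-column i) ≡ Y.walk Y.lo → i ≡ start
      V-column-min i with y i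
      ... | Sign.+ = on-arc-min
      ... | Sign.- = λ on at-min → contradiction at-min (on-arc-next-not-min on)

      good-crossing : ∀ i → Good (V i cut) → i ≡ start
      good-crossing i (level≡v , on) = V-column-min i (subst OnArc (column-hd-V i cut) on) (begin
        Y.walk (V-column i)                             ≡⟨ cancel (X.walk X.lo) (Y.walk (V-column i)) ⟩
        X.walk X.lo - (X.walk X.lo - Y.walk (V-column i)) ≡⟨ cong (_-_ (X.walk X.lo)) (trans (sym (level-V i X.lo)) level≡v) ⟩
        X.walk X.lo - (X.walk X.lo - Y.walk Y.lo)       ≡⟨ cancel (X.walk X.lo) (Y.walk Y.lo) ⟨
        Y.walk Y.lo                                     ∎)
        where
        open ≡-Reasoning
        cancel : ∀ a b → b ≡ a - (a - b)
        cancel = solve-∀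

      start-ascends : y start ≡ Sign.+
      start-ascends = ascent-at-min Y start-min

      good-first : Good (V start cut)
      good-first = trans (level-V start X.lo) (cong (_-_ (X.walk X.lo)) (trans (cong Y.walk (V-column-ascent start-ascends)) start-min))
                 , subst OnArc (sym (column-hd-V start cut)) (0 , z≤n , refl)

      crossing-only-at-start : ∀ e → Good e → e ≢ V start cut → Crossing.crossing m n x y cut e ≡ + 0
      crossing-only-at-start (H i j) _ _ = refl
      crossing-only-at-start (V i j) good-e e≢ with j FP.≟ cut
      ... | no _     = refl
      ... | yes refl = contradiction (cong (λ a → V a cut) (good-crossing i good-e)) e≢

      winding-from-start : ∀ (ℓ : Loop) → edge ℓ zero ≡ V start cut → Δy ℓ ≡ + suc n
      winding-from-start ℓ starts = begin
        Δy ℓ                                                               ≡⟨ Δy≡crossings ℓ ⟩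
        + suc n * sum (crossing ∘ edge ℓ)                                  ≡⟨⟩
        + suc n * (crossing (edge ℓ zero) + sum (crossing ∘ edge ℓ ∘ suc))
                                                                           ≡⟨ cong (λ s → + suc n * s) (cong₂ _+_ first-crossing no-other-crossing) ⟩
        + suc n * + 1                                                      ≡⟨ ℤP.*-identityʳ (+ suc n) ⟩
        + suc n                                                            ∎
        where
        open ≡-Reasoning
        open Crossing m n x y cut
        good : ∀ t → Good (edge ℓ t)
        good = cyclic-induction (Good ∘ edge ℓ) (subst Good (sym starts) good-first)
                 (λ t good-t → subst Good (sym (edge-next ℓ t)) (good-step (edge ℓ t) good-t))
        first-crossing : crossing (edge ℓ zero) ≡ + 1
        first-crossing = trans (cong crossing starts) (trans (crossing-cut start) (cong val start-ascends))
        uncrossed : ∀ t → crossing (edge ℓ (suc t)) ≡ + 0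
        uncrossed t = crossing-only-at-start (edge ℓ (suc t)) (good (suc t))
                        (λ eₜ≡ → contradiction (circ ℓ (trans eₜ≡ (sym starts))) λ ())
        no-other-crossing : sum (crossing ∘ edge ℓ ∘ suc) ≡ + 0
        no-other-crossing = trans (sum-cong-≗ uncrossed) (sum-replicate-zero (len ℓ))

    vertical-loop : ∃[ ℓ ] Δy ℓ ≡ + suc n
    vertical-loop = proj₁ through , Along.winding-from-start arc (proj₁ through) (proj₂ through)
      where
      through = loop-through (V (Arc.start arc) cut)

module Windings (m n : ℕ) (x : Fin (suc n) → Sign) (y : Fin (suc m) → Sign)
                {rx ry : ℤ} (X : Profile x rx) (Y : Profile y ry) where

  open Cloth m n x y

  private
    module Direct         = Levels m n x y X Y
    module Swapped        = Levels n m y x Y X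
    module Negated        = Levels m n (neg x) (neg y) (neg-profile X) (neg-profile Y)
    module NegSwapped     = Levels n m (neg y) (neg x) (neg-profile Y) (neg-profile X)
    module ToSwapped      = Transpose n m y x
    module FromSwapped    = Transpose m n x y
    module FromNegSwapped = Transpose m n (neg x) (neg y)
    module FromNegated    = Reverse m n x y

  no-vertical-winding : ry ≤ rx → ∀ ℓ → Δy ℓ ≡ + 0
  no-vertical-winding = Direct.no-vertical-winding

  no-horizontal-winding : rx ≤ ry → ∀ ℓ → Δx ℓ ≡ + 0
  no-horizontal-winding rx≤ry ℓ =
    trans (sym (ToSwapped.Δy-transpose ℓ)) (Swapped.no-vertical-winding rx≤ry (ToSwapped.transpose-loop ℓ))

  upward-loop : rx < ry → ∃[ ℓ ] Δy ℓ ≡ + suc n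
  upward-loop = Direct.Upward.vertical-loop

  downward-loop : rx < ry → ∃[ ℓ ] Δy ℓ ≡ - + suc n
  downward-loop rx<ry =
    map FromNegated.reverse-loop (λ {ℓ} Δy≡ → trans (FromNegated.Δy-reverse ℓ) (cong -_ Δy≡))
        (Negated.Upward.vertical-loop rx<ry)

  rightward-loop : ry < rx → ∃[ ℓ ] Δx ℓ ≡ + suc m
  rightward-loop ry<rx =
    map FromSwapped.transpose-loop (λ {ℓ} Δy≡ → trans (FromSwapped.Δx-transpose ℓ) Δy≡)
        (Swapped.Upward.vertical-loop ry<rx)

  leftward-loop : ry < rx → ∃[ ℓ ] Δx ℓ ≡ - + suc m
  leftward-loop ry<rx =
    map (FromNegated.reverse-loop ∘ FromNegSwapped.transpose-loop)
        (λ {ℓ} Δy≡ → trans (FromNegated.Δx-reverse (FromNegSwapped.transpose-loop ℓ))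
                           (cong -_ (trans (FromNegSwapped.Δx-transpose ℓ) Δy≡)))
        (NegSwapped.Upward.vertical-loop ry<rx)

  upward-class : rx < ry → ∃[ ℓ ] HasClass ℓ (+ 0) (+ 1)
  upward-class rx<ry =
    map₂ (λ {ℓ} Δy≡ → no-horizontal-winding (ℤP.<⇒≤ rx<ry) ℓ , trans Δy≡ (sym (ℤP.*-identityˡ (+ suc n))))
         (upward-loop rx<ry)

  downward-class : rx < ry → ∃[ ℓ ] HasClass ℓ (+ 0) (- + 1)
  downward-class rx<ry =
    map₂ (λ {ℓ} Δy≡ → no-horizontal-winding (ℤP.<⇒≤ rx<ry) ℓ , trans Δy≡ (sym (ℤP.-1*i≡-i (+ suc n))))
         (downward-loop rx<ry)

  rightward-class : ry < rx → ∃[ ℓ ] HasClass ℓ (+ 1) (+ 0)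
  rightward-class ry<rx =
    map₂ (λ {ℓ} Δx≡ → trans Δx≡ (sym (ℤP.*-identityˡ (+ suc m))) , no-vertical-winding (ℤP.<⇒≤ ry<rx) ℓ)
         (rightward-loop ry<rx)

  leftward-class : ry < rx → ∃[ ℓ ] HasClass ℓ (- + 1) (+ 0)
  leftward-class ry<rx =
    map₂ (λ {ℓ} Δx≡ → trans Δx≡ (sym (ℤP.-1*i≡-i (+ suc m))) , no-vertical-winding (ℤP.<⇒≤ ry<rx) ℓ)
         (leftward-loop ry<rx)

  trivial-class-only : rx ≡ ry → ∀ ℓ → HasClass ℓ (+ 0) (+ 0)
  trivial-class-only rx≡ry ℓ =
    no-horizontal-winding (ℤP.≤-reflexive rx≡ry) ℓ , no-vertical-winding (ℤP.≤-reflexive (sym rx≡ry)) ℓ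

corollary1p3 : (m n : ℕ) (x : Fin (suc n) → Sign) (y : Fin (suc m) → Sign)
  → Σz n x ≡ + 0 → Σz m y ≡ + 0
  → (rx ry : ℤ) → IsRange n x rx → IsRange m y ry
  → (rx < ry → (∃[ ℓ ] Cloth.HasClass m n x y ℓ (+ 0) (+ 1))
               × (∃[ ℓ ] Cloth.HasClass m n x y ℓ (+ 0) (- (+ 1))))
  × (rx ≡ ry → ∀ ℓ → Cloth.HasClass m n x y ℓ (+ 0) (+ 0))
  × (ry < rx → (∃[ ℓ ] Cloth.HasClass m n x y ℓ (+ 1) (+ 0))
               × (∃[ ℓ ] Cloth.HasClass m n x y ℓ (- (+ 1)) (+ 0)))
corollary1p3 m n x y Σx≡0 Σy≡0 rx ry x-range y-range =
  (λ rx<ry → upward-class rx<ry , downward-class rx<ry) ,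
  trivial-class-only ,
  (λ ry<rx → rightward-class ry<rx , leftward-class ry<rx)
  where open Windings m n x y (profile n x Σx≡0 x-range) (profile m y Σy≡0 y-range)
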